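{- Assume Markov induction. Let $\chi,\chi':\mathbb{N}\to\nabla_0 2$ be oracles and suppose there is a group isomorphism $\theta:\nabla_0\big(\Omega(\mathcal{U},\bigcirc_\chi\mathbb{N})\big)\simeq\nabla_0\big(\Omega(\mathcal{U},\bigcirc_{\chi'}\mathbb{N})\big)$. Then $\neg\neg(\chi\equiv_T\chi')$.
   Context: Setting: homotopy type theory with a univalent universe $\mathcal{U}$ of small types and higher inductive types. It is assumed that there is a small type $\Omega_{\neg\neg}:\mathcal{U}$ classifying $\neg\neg$-stable propositions. For a type $X$, $\nabla_0X$ is the type of $\xi:X\to\Omega_{\neg\neg}$ such that $\neg\neg\sum_{x:X}\xi(x)$ and $\prod_{x,y:X}\xi(x)\to\xi(y)\to\neg\neg(x=y)$; write $\xi\downarrow:=\sum_{x:X}\xi(x)$ and $\xi\downarrow=x$ for $\xi(x)$; $\nabla_0$ is a higher modality preserving finite products. For a pointed type $(X,x)$, $\Omega(X,x)$ is the loop space $x=_Xx$, a group under path concatenation; $\Omega(\mathcal{U},Y)$ is the type $Y=Y$ of self-equivalences (by univalence) of $Y$, and $\nabla_0\Omega(\mathcal{U},Y)$ carries the group structure induced by applying $\nabla_0$ to concatenation. For a higher modality $\bigcirc$, a type is $\bigcirc$-connected if $\bigcirc X$ is contractible. The nullification at a family $B:A\to\mathcal{U}$ is the higher modality whose modal types are the $X$ with every constant map $X\to X^{B(a)}$ an equivalence. An oracle is a map $\chi:A\to\nabla_0B$; $\bigcirc_\chi$ is the nullification at $a\mapsto\chi(a)\downarrow$. $\chi\equiv_T\chi'$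 means $\bigcirc_\chi=\bigcirc_{\chi'}$, i.e. the $\bigcirc_\chi$-connected and $\bigcirc_{\chi'}$-connected types coincide. Markov induction (MI): with $\mathtt{IsSuc}(\mu,\nu):=\prod_{m}(\mu\downarrow=m)\to(\nu\downarrow=m+1)$ on $\nabla_0\mathbb{N}$, for every $P:\nabla_0\mathbb{N}\to\mathcal{U}$ and $h:\prod_\nu(\prod_\mu\mathtt{IsSuc}(\mu,\nu)\to P(\mu))\to P(\nu)$ there is a section $\prod_\nu P(\nu)$. -}

{-# OPTIONS --without-K #-}

-- The universe 𝒰 of small types is Set and identity types are _≡_, without K.
-- Univalence, function extensionality, the classifier Ω¬¬ and nullifications
-- enter as hypotheses, whose types are defined here.  K would refute
-- Univalence, so any module using these definitions should use --without-K.

module Defs where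

open import Level using (Level; Setω; _⊔_; 0ℓ) renaming (suc to lsuc)
open import Algebra.Bundles using (Group)
open import Algebra.Morphism.Structures using (module GroupMorphisms)
open import Axiom.Extensionality.Propositional using (Extensionality)
open import Data.Nat.Base using (ℕ; suc)
open import Data.Product.Base using (Σ; Σ-syntax; _×_; _,_; proj₁; proj₂; uncurry)
open import Data.Product.Function.NonDependent.Propositional using (_×-↔_)
open import Function.Base using (id; _∘_)
open import Function.Bundles using (_⇔_; _↔_; mk↔ₛ′; module Inverse)
open import Relation.Binary.PropositionalEquality
open import Relation.Nullary using (¬_; Irrelevant)
open import Relation.Nullary.Negation using (Stable; contradiction)

private
  variable
    a b ℓ : Level

isContr : Set a → Set a
isContr A = Σ[ c ∈ A ] (∀ x → c ≡ x)

fiber : {A : Set a} {B : Set b} → (A → B) → B → Set (a ⊔ b)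
fiber {A = A} f y = Σ[ x ∈ A ] f x ≡ y

isEquiv : {A : Set a} {B : Set b} → (A → B) → Set (a ⊔ b)
isEquiv f = ∀ y → isContr (fiber f y)

_≃_ : Set a → Set b → Set (a ⊔ b)
A ≃ B = Σ[ f ∈ (A → B) ] isEquiv f

id-isEquiv : {A : Set a} → isEquiv (id {A = A})
id-isEquiv y = (y , refl) , λ { (_ , refl) → refl }

≡⇒≃ : {X Y : Set} → X ≡ Y → X ≃ Y
≡⇒≃ refl = id , id-isEquiv

Univalence : Set₁
Univalence = (X Y : Set) → isEquiv (≡⇒≃ {X} {Y})

FunExt : Setω
FunExt = ∀ {a b} → Extensionality a b

-- The computation rule of the induction principle holds up to _≡_.

record HigherModality : Set₁ where
  field
    ○       : Set → Set
    η       : {X : Set} → X → ○ X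
    ○-ind   : {X : Set} (P : ○ X → Set) →
              ((x : X) → ○ (P (η x))) → (z : ○ X) → ○ (P z)
    ○-ind-η : {X : Set} (P : ○ X → Set) (f : (x : X) → ○ (P (η x))) →
              ∀ x → ○-ind P f (η x) ≡ f x
    η-≡     : {X : Set} (z w : ○ X) → isEquiv (η {z ≡ w})

  isModal : Set → Set
  isModal X = isEquiv (η {X})

  isConnected : Set → Set
  isConnected X = isContr (○ X)

isNull : {A : Set} → (A → Set) → Set → Set
isNull {A} B X = ∀ (a : A) → isEquiv (λ (x : X) (_ : B a) → x)

-- By univalence a higher modality is determined by its modal types, so
-- Nullification B has at most one element up to _≡_.

record Nullification {A : Set} (B : A → Set) : Set₁ where
  field
    modality   : HigherModality
  open HigherModality modality public
  field
    modal⇔null : (X : Set) → isModal X ⇔ isNull B X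

HasNullifications : Set₁
HasNullifications = {A : Set} (B : A → Set) → Nullification B

StableProp : Set₁
StableProp = Σ[ P ∈ Set ] Irrelevant P × Stable P

record StablePropClassifier : Set₁ where
  field
    Ω¬¬            : Set
    decode         : Ω¬¬ → StableProp
    decode-isEquiv : isEquiv decode

  ⟦_⟧ : Ω¬¬ → Set
  ⟦ ω ⟧ = proj₁ (decode ω)

module Nabla (C : StablePropClassifier) where

  open StablePropClassifier C

  ∇₀ : Set ℓ → Set ℓ
  ∇₀ X = Σ[ ξ ∈ (X → Ω¬¬) ]
           ¬ ¬ (Σ[ x ∈ X ] ⟦ ξ x ⟧) ×
           (∀ x y → ⟦ ξ x ⟧ → ⟦ ξ y ⟧ → ¬ ¬ (x ≡ y))

  infix 4 _↓=_
  infix 8 _↓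

  _↓=_ : {X : Set ℓ} → ∇₀ X → X → Set
  ξ ↓= x = ⟦ proj₁ ξ x ⟧

  _↓ : {X : Set ℓ} → ∇₀ X → Set ℓ
  _↓ {X = X} ξ = Σ[ x ∈ X ] ξ ↓= x

  IsSuc : ∇₀ ℕ → ∇₀ ℕ → Set
  IsSuc μ ν = ∀ m → μ ↓= m → ν ↓= suc m

  MarkovInduction : Set₁
  MarkovInduction =
    (P : ∇₀ ℕ → Set) →
    (∀ ν → (∀ μ → IsSuc μ ν → P μ) → P ν) →
    ∀ ν → P ν

  module Oracles (null : HasNullifications) where

    Oracle : Set → Set → Set
    Oracle A B = A → ∇₀ B

    nullOracle : {A B : Set} (χ : Oracle A B) → Nullification (λ a → χ a ↓)
    nullOracle χ = null (λ a → χ a ↓)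

    ○[_] : {A B : Set} → Oracle A B → Set → Set
    ○[ χ ] = Nullification.○ (nullOracle χ)

    isConnected[_] : {A B : Set} → Oracle A B → Set → Set
    isConnected[ χ ] = Nullification.isConnected (nullOracle χ)

    -- Equality of the two modalities, expressed through their connected types.

    infix 4 _≡T_

    _≡T_ : {A B A′ B′ : Set} → Oracle A B → Oracle A′ B′ → Set₁
    χ ≡T χ′ = (X : Set) → isConnected[ χ ] X ⇔ isConnected[ χ′ ] X

Ω𝒰 : Set → Set₁
Ω𝒰 Y = Y ≡ Y

-- Ω𝒰 Y is a large type, but Ω¬¬ classifies small propositions only.  By
-- univalence Ω𝒰 Y is essentially small, which is enough for the action of ∇₀
-- on maps.

Small : Set ℓ → Set (lsuc 0ℓ ⊔ ℓ)
Small X = Σ[ X′ ∈ Set ] X ↔ X′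

isEquiv⇒↔ : {A : Set a} {B : Set b} {f : A → B} → isEquiv f → A ↔ B
isEquiv⇒↔ {f = f} e = mk↔ₛ′ f
  (λ y → proj₁ (proj₁ (e y)))
  (λ y → proj₂ (proj₁ (e y)))
  (λ x → cong proj₁ (proj₂ (e (f x)) (x , refl)))

Small-Ω𝒰 : Univalence → (Y : Set) → Small (Ω𝒰 Y)
Small-Ω𝒰 ua Y = Y ≃ Y , isEquiv⇒↔ (ua Y Y)

Small-× : {X : Set a} {Y : Set b} → Small X → Small Y → Small (X × Y)
Small-× (X′ , i) (Y′ , j) = (X′ × Y′) , (i ×-↔ j)

module NablaGroup
  (fe : FunExt) (ua : Univalence) (C : StablePropClassifier) where

  open StablePropClassifier C
  open Nabla C

  ¬-irr : {A : Set a} → Irrelevant (¬ A)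
  ¬-irr f g = fe λ x → contradiction x f

  ¬¬-prop : Set → StableProp
  ¬¬-prop P = (¬ ¬ P) , ¬-irr , λ n k → n (λ p → p k)

  ¬¬-map : {A : Set a} {B : Set b} → (A → B) → ¬ ¬ A → ¬ ¬ B
  ¬¬-map f n k = n (k ∘ f)

  ⟦⟧-irr : ∀ ω → Irrelevant ⟦ ω ⟧
  ⟦⟧-irr ω = proj₁ (proj₂ (decode ω))

  ⟦⟧-stable : ∀ ω → Stable ⟦ ω ⟧
  ⟦⟧-stable ω = proj₂ (proj₂ (decode ω))

  ⌜_⌝ : Set → Ω¬¬
  ⌜ P ⌝ = proj₁ (proj₁ (decode-isEquiv (¬¬-prop P)))

  ⌜⌝-≡ : ∀ P → ⟦ ⌜ P ⌝ ⟧ ≡ (¬ ¬ P)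
  ⌜⌝-≡ P = cong proj₁ (proj₂ (proj₁ (decode-isEquiv (¬¬-prop P))))

  ⌜⌝-intro : ∀ {P} → ¬ ¬ P → ⟦ ⌜ P ⌝ ⟧
  ⌜⌝-intro {P} = subst id (sym (⌜⌝-≡ P))

  ⌜⌝-elim : ∀ {P} → ⟦ ⌜ P ⌝ ⟧ → ¬ ¬ P
  ⌜⌝-elim {P} = subst id (⌜⌝-≡ P)

  η₀ : {X : Set ℓ} → Small X → X → ∇₀ X
  η₀ {X = X} (X′ , i) x =
    (λ y → ⌜ to x ≡ to y ⌝) ,
    (λ k → k (x , ⌜⌝-intro (λ k′ → k′ refl))) ,
    (λ y z p q k → ⌜⌝-elim p λ p′ → ⌜⌝-elim q λ q′ →
      k (to-injective (trans (sym p′) q′)))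
    where
    open Inverse i using (to; from; strictlyInverseʳ)
    to-injective : ∀ {y z} → to y ≡ to z → y ≡ z
    to-injective {y} {z} e =
      trans (sym (strictlyInverseʳ y)) (trans (cong from e) (strictlyInverseʳ z))

  -- map f ξ holds at y iff ¬¬ Σ x , ξ x × f x ≡ y, with x and the equality
  -- transferred to the small copies of X and Y.

  map : {X : Set a} {Y : Set b} → Small X → Small Y → (X → Y) → ∇₀ X → ∇₀ Y
  map {X = X} {Y} (X′ , i) (Y′ , j) f ξ =
    (λ y → ⌜ Img y ⌝) ,
    ¬¬-map (λ { (x , p) → f x , ⌜⌝-intro (λ k → k (img x p)) }) (proj₁ (proj₂ ξ)) ,
    (λ y z p q k → ⌜⌝-elim p λ { (x₁ , p₁ , e₁) → ⌜⌝-elim q λ { (x₂ , p₂ , e₂) →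
      proj₂ (proj₂ ξ) _ _ p₁ p₂ λ e →
      k (J.injective (trans (sym e₁) (trans (cong (J.to ∘ f) e) e₂))) } })
    where
    module I = Inverse i
    module J where
      open Inverse j public
      injective : ∀ {y z} → to y ≡ to z → y ≡ z
      injective {y} {z} e =
        trans (sym (strictlyInverseʳ y)) (trans (cong from e) (strictlyInverseʳ z))
    Img : Y → Set
    Img y = Σ[ x′ ∈ X′ ] (ξ ↓= I.from x′) × (J.to (f (I.from x′)) ≡ J.to y)
    img : ∀ x → ξ ↓= x → Img (f x)
    img x p = I.to x ,
      subst (ξ ↓=_) (sym (I.strictlyInverseʳ x)) p ,
      cong (J.to ∘ f) (I.strictlyInverseʳ x)

  pair : {X : Set a} {Y : Set b} → ∇₀ X → ∇₀ Y → ∇₀ (X × Y)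
  pair ξ ζ =
    (λ { (x , y) → ⌜ (ξ ↓= x) × (ζ ↓= y) ⌝ }) ,
    (λ k → proj₁ (proj₂ ξ) λ { (x , p) → proj₁ (proj₂ ζ) λ { (y , q) →
      k ((x , y) , ⌜⌝-intro (λ k′ → k′ (p , q))) } }) ,
    (λ { (x , y) (x′ , y′) p p′ k →
      ⌜⌝-elim p λ { (p₁ , p₂) → ⌜⌝-elim p′ λ { (p₁′ , p₂′) →
      proj₂ (proj₂ ξ) x x′ p₁ p₁′ λ e →
      proj₂ (proj₂ ζ) y y′ p₂ p₂′ λ e′ →
      k (cong₂ _,_ e e′) } } })

  η₀-↓= : {X : Set ℓ} (s : Small X) (x : X) → η₀ s x ↓= x
  η₀-↓= s x = ⌜⌝-intro (λ k → k refl)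

  map-↓= : {X : Set a} {Y : Set b} (s : Small X) (t : Small Y) (f : X → Y)
           (ξ : ∇₀ X) {x : X} → ξ ↓= x → map s t f ξ ↓= f x
  map-↓= (X′ , i) (Y′ , j) f ξ {x} p = ⌜⌝-intro λ k → k
    ( I.to x
    , subst (ξ ↓=_) (sym (I.strictlyInverseʳ x)) p
    , cong (Inverse.to j ∘ f) (I.strictlyInverseʳ x))
    where module I = Inverse i

  pair-↓= : {X : Set a} {Y : Set b} (ξ : ∇₀ X) (ζ : ∇₀ Y) {x : X} {y : Y} →
            ξ ↓= x → ζ ↓= y → pair ξ ζ ↓= (x , y)
  pair-↓= ξ ζ p q = ⌜⌝-intro λ k → k (p , q)

  Σ-≡ : {A : Set a} {B : A → Set b} → (∀ x → Irrelevant (B x)) →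
        {u v : Σ A B} → proj₁ u ≡ proj₁ v → u ≡ v
  Σ-≡ irr {x , p} {_ , q} refl = cong (x ,_) (irr x p q)

  Irrelevant⇒isSet : {A : Set} → Irrelevant A → {x y : A} (p q : x ≡ y) → p ≡ q
  Irrelevant⇒isSet irr {x} p q = trans (sym (lem p)) (lem q)
    where
    lem : ∀ {z} (r : x ≡ z) → trans (sym (irr x x)) (irr x z) ≡ r
    lem refl = trans-symˡ (irr x x)

  propExt : {P Q : Set} → Irrelevant P → Irrelevant Q → (P → Q) → (Q → P) → P ≡ Q
  propExt {P} {Q} irrP irrQ f g = proj₁ (proj₁ (ua P Q (f , f-isEquiv)))
    where
    f-isEquiv : isEquiv f
    f-isEquiv y = (g y , irrQ _ y) ,
      λ { (x , e) → Σ-≡ (λ _ → Irrelevant⇒isSet irrQ) (irrP (g y) x) }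

  Ω¬¬-ext : ∀ {ω ω′} → (⟦ ω ⟧ → ⟦ ω′ ⟧) → (⟦ ω′ ⟧ → ⟦ ω ⟧) → ω ≡ ω′
  Ω¬¬-ext {ω} {ω′} f g = begin
    ω                        ≡⟨ strictlyInverseʳ ω ⟨
    from (decode ω)          ≡⟨ cong from decode-≡ ⟩
    from (decode ω′)         ≡⟨ strictlyInverseʳ ω′ ⟩
    ω′                       ∎
    where
    open ≡-Reasoning
    open Inverse (isEquiv⇒↔ decode-isEquiv) using (from; strictlyInverseʳ)
    isStableProp-irr : (P : Set) → Irrelevant (Irrelevant P × Stable P)
    isStableProp-irr P (i , s) (i′ , s′) = cong₂ _,_
      (fe λ x → fe λ y → Irrelevant⇒isSet i (i x y) (i′ x y))
      (fe λ n → i (s n) (s′ n))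
    decode-≡ : decode ω ≡ decode ω′
    decode-≡ = Σ-≡ isStableProp-irr (propExt (⟦⟧-irr ω) (⟦⟧-irr ω′) f g)

  overlap⇒≡ : {X : Set ℓ} {ξ ζ : ∇₀ X} →
              ¬ ¬ (Σ[ x ∈ X ] (ξ ↓= x) × (ζ ↓= x)) → ξ ≡ ζ
  overlap⇒≡ {X = X} {ξ} {ζ} o = Σ-≡ irr (fe λ y → Ω¬¬-ext (to y) (from y))
    where
    irr : ∀ _ → Irrelevant _
    irr _ (p , q) (p′ , q′) = cong₂ _,_ (¬-irr p p′)
      (fe λ x → fe λ y → fe λ s → fe λ t → ¬-irr (q x y s t) (q′ x y s t))
    to : ∀ y → ξ ↓= y → ζ ↓= y
    to y p = ⟦⟧-stable _ λ k → o λ { (x , s , t) →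
      proj₂ (proj₂ ξ) x y s p λ e → k (subst (ζ ↓=_) e t) }
    from : ∀ y → ζ ↓= y → ξ ↓= y
    from y p = ⟦⟧-stable _ λ k → o λ { (x , s , t) →
      proj₂ (proj₂ ζ) x y t p λ e → k (subst (ξ ↓=_) e s) }

  total : {X : Set ℓ} (ξ : ∇₀ X) → ¬ ¬ (ξ ↓)
  total ξ = proj₁ (proj₂ ξ)

  module LoopGroup (Y : Set) where

    infixl 7 _∙_
    infix  8 _⁻¹

    small : Small (Ω𝒰 Y)
    small = Small-Ω𝒰 ua Y

    _∙_ : ∇₀ (Ω𝒰 Y) → ∇₀ (Ω𝒰 Y) → ∇₀ (Ω𝒰 Y)
    ξ ∙ ζ = map (Small-× small small) small (uncurry trans) (pair ξ ζ)

    ε : ∇₀ (Ω𝒰 Y)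
    ε = η₀ small refl

    _⁻¹ : ∇₀ (Ω𝒰 Y) → ∇₀ (Ω𝒰 Y)
    _⁻¹ = map small small sym

    ∙-↓= : ∀ ξ ζ {p q} → ξ ↓= p → ζ ↓= q → (ξ ∙ ζ) ↓= trans p q
    ∙-↓= ξ ζ s t = map-↓= (Small-× small small) small (uncurry trans) (pair ξ ζ)
      (pair-↓= ξ ζ s t)

    ε-↓= : ε ↓= refl
    ε-↓= = η₀-↓= small refl

    ⁻¹-↓= : ∀ ξ {p} → ξ ↓= p → (ξ ⁻¹) ↓= sym p
    ⁻¹-↓= ξ = map-↓= small small sym ξ

    assoc : ∀ ξ ζ ω → (ξ ∙ ζ) ∙ ω ≡ ξ ∙ (ζ ∙ ω)
    assoc ξ ζ ω = overlap⇒≡ λ k →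
      total ξ λ { (p , s) → total ζ λ { (q , t) → total ω λ { (r , u) →
      k ( _ , ∙-↓= (ξ ∙ ζ) ω (∙-↓= ξ ζ s t) u
        , subst ((ξ ∙ (ζ ∙ ω)) ↓=_) (sym (trans-assoc p))
            (∙-↓= ξ (ζ ∙ ω) s (∙-↓= ζ ω t u))) } } }

    identityˡ : ∀ ξ → ε ∙ ξ ≡ ξ
    identityˡ ξ = overlap⇒≡ λ k → total ξ λ { (p , s) →
      k (p , ∙-↓= ε ξ ε-↓= s , s) }

    identityʳ : ∀ ξ → ξ ∙ ε ≡ ξ
    identityʳ ξ = overlap⇒≡ λ k → total ξ λ { (p , s) →
      k (_ , ∙-↓= ξ ε s ε-↓= , subst (ξ ↓=_) (sym (trans-reflʳ p)) s) }

    inverseˡ : ∀ ξ → (ξ ⁻¹) ∙ ξ ≡ ε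
    inverseˡ ξ = overlap⇒≡ λ k → total ξ λ { (p , s) →
      k (_ , ∙-↓= (ξ ⁻¹) ξ (⁻¹-↓= ξ s) s , subst (ε ↓=_) (sym (trans-symˡ p)) ε-↓=) }

    inverseʳ : ∀ ξ → ξ ∙ (ξ ⁻¹) ≡ ε
    inverseʳ ξ = overlap⇒≡ λ k → total ξ λ { (p , s) →
      k (_ , ∙-↓= ξ (ξ ⁻¹) s (⁻¹-↓= ξ s) , subst (ε ↓=_) (sym (trans-symʳ p)) ε-↓=) }

  ∇₀Ω𝒰 : Set → Group (lsuc 0ℓ) (lsuc 0ℓ)
  ∇₀Ω𝒰 Y = record
    { Carrier = ∇₀ (Ω𝒰 Y)
    ; _≈_     = _≡_
    ; _∙_     = _∙_
    ; ε       = ε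
    ; _⁻¹     = _⁻¹
    ; isGroup = record
      { isMonoid = record
        { isSemigroup = record
          { isMagma = record { isEquivalence = isEquivalence ; ∙-cong = cong₂ _∙_ }
          ; assoc   = assoc
          }
        ; identity = identityˡ , identityʳ
        }
      ; inverse = inverseˡ , inverseʳ
      ; ⁻¹-cong = cong _⁻¹
      }
    }
    where open LoopGroup Y

IsGroupIso : ∀ {c c′} (G : Group a c) (H : Group b c′) →
             (Group.Carrier G → Group.Carrier H) → Set (a ⊔ b ⊔ c ⊔ c′)
IsGroupIso G H = GroupMorphisms.IsGroupIsomorphism (Group.rawGroup G) (Group.rawGroup H)

{-# OPTIONS --without-K #-}
module Submission where

-- Double negation turns the elements of ∇₀ (Ω𝒰 (○ ℕ)) into permutations of ○ ℕ, a
-- set with stable equality whose points are, up to ¬¬, the natural numbers.  Among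
-- them the transpositions are definable in the language of groups: t² = 1, t ≠ 1,
-- and (t g t g)⁶ = 1 for all g with g² = 1.  (Two distinct pairs moved by t, together
-- with a fixed point or with two further pairs, give a g such that t g t g has order
-- 5 or 4 on some orbit.)  Hence θ maps transpositions to transpositions.
-- Choose χ-computable permutations f, g and a transposition u such that g⁻ⁿ f gⁿ
-- commutes with u iff χ(n) is false.  If V, W represent θ(f), θ(g) and θ(u) is the
-- transposition (p q), then W⁻ⁿ V Wⁿ commutes with (p q) iff it does so at the one
-- point p, which compares two elements of ○′ ℕ and so makes χ(n) computable from χ′.

open import Defs
open import Level using (Level)
open import Algebra.Bundles using (Group)
open import Algebra.Morphism.Structures using (module GroupMorphisms)
open import Data.Bool.Base using (Bool; true; false)
import Data.Bool.Properties as Bool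
open import Data.Empty using (⊥)
open import Data.Fin.Base using (Fin; zero; suc; opposite; lift)
open import Data.Fin.Patterns
open import Data.Fin.Properties using (any?; opposite-involutive)
open import Data.Nat.Base using (ℕ; zero; suc; _+_; _<_; _⊔_)
import Data.Nat.Properties as ℕ
open import Data.Product.Base using (Σ; Σ-syntax; _×_; _,_; proj₁; proj₂)
open import Data.Vec.Base using (Vec; []; _∷_; lookup)
open import Data.Vec.Relation.Unary.All as All using (All; []; _∷_)
open import Data.Vec.Relation.Unary.All.Properties using (lookup⁺; lookup⁻)
open import Data.Vec.Relation.Unary.AllPairs using ([]; _∷_)
open import Data.Vec.Relation.Unary.Unique.Propositional using (Unique)
open import Data.Vec.Relation.Unary.Unique.Propositional.Properties using (lookup-injective)
open import Function.Base using (id; const; _∘_)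
open import Function.Bundles using (_↔_; mk↔ₛ′; module Inverse; module Equivalence; mk⇔; mk↣)
open import Function.Definitions using (Injective)
open import Function.Properties.Inverse.HalfAdjointEquivalence using (↔⇒≃)
open import Relation.Binary.Definitions using (DecidableEquality)
open import Relation.Binary.PropositionalEquality
open import Relation.Nullary using (¬_; Dec; yes; no; Irrelevant)
open import Relation.Nullary.Decidable using (¬¬-excluded-middle; via-injection; decidable-stable)
open import Relation.Nullary.Negation using (Stable; contradiction)

private
  variable
    a b : Level
    A B X Y : Set

-- Contracting a fibre needs the triangle identity, which the half-adjoint form of the inverse data
-- supplies.
↔⇒isEquiv : (i : A ↔ B) → isEquiv (Inverse.to i)
↔⇒isEquiv i y = (from y , right-inverse-of y) ,
  λ { (x , refl) → contract (left-inverse-of x) (left-right x) }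
  where
  open Function.Properties.Inverse.HalfAdjointEquivalence._≃_ (↔⇒≃ i)
  contract : ∀ {x x′} (p : x′ ≡ x) {q : to x′ ≡ to x} → cong to p ≡ q →
             _≡_ {A = fiber to (to x)} (x′ , q) (x , refl)
  contract refl refl = refl

by-cases : ∀ {G : Set a} (P : Set b) → Stable G → (Dec P → G) → G
by-cases _ s f = s λ k → ¬¬-excluded-middle (k ∘ f)

-- Higher modalities

module Modality (M : HigherModality) where

  open HigherModality M

  bind : (A → ○ B) → ○ A → ○ B
  bind {B = B} = ○-ind (λ _ → B)

  bind-η : (f : A → ○ B) (x : A) → bind f (η x) ≡ f x
  bind-η {B = B} = ○-ind-η (λ _ → B)

  map : (A → B) → ○ A → ○ B
  map f = bind (η ∘ f)

  map-η : (f : A → B) (x : A) → map f (η x) ≡ η (f x)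
  map-η f = bind-η (η ∘ f)

  into-modal : isModal B → ○ A → (A → B) → B
  into-modal m z f = Inverse.from (isEquiv⇒↔ m) (map f z)

  into-modal-η : (m : isModal B) (x : A) (f : A → B) → into-modal m (η x) f ≡ f x
  into-modal-η m x f =
    trans (cong from (map-η f x)) (strictlyInverseʳ (f x))
    where open Inverse (isEquiv⇒↔ m)

  into-≡ : {z w : ○ B} → ○ A → (A → z ≡ w) → z ≡ w
  into-≡ = into-modal (η-≡ _ _)

  -- By induction, as `x` itself serves at `η x`. Proofs of modal statements can thereby treat a
  -- point of `○ A` as some `η x`.
  attained : (z : ○ A) → ○ (Σ[ x ∈ A ] η x ≡ z)
  attained = ○-ind (λ z → Σ[ x ∈ _ ] η x ≡ z) (λ x → η (x , refl))

  ○-≡-elim : (f g : ○ A → ○ B) → (∀ x → f (η x) ≡ g (η x)) → ∀ z → f z ≡ g z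
  ○-≡-elim f g h z = into-≡ (attained z) λ { (x , refl) → h x }

  map-inverse : {r s : A → A} → (∀ d → r (s d) ≡ d) → ∀ z → map r (map s z) ≡ z
  map-inverse {r = r} {s} h = ○-≡-elim (map r ∘ map s) id λ d →
    trans (cong (map r) (map-η s d)) (trans (map-η r (s d)) (cong η (h d)))

  ○-modal : (A : Set) → isModal (○ A)
  ○-modal A = ↔⇒isEquiv (mk↔ₛ′ η (bind id)
    (○-≡-elim (η ∘ bind id) id (λ z → cong η (bind-η id z)))
    (bind-η id))

  ○-irrelevant : Irrelevant A → Irrelevant (○ A)
  ○-irrelevant irr z w = into-≡ (attained z) λ { (x , refl) →
    into-≡ (attained w) λ { (y , refl) → cong η (irr x y) } }

-- The unit of `N` factors through the contractible `M.○ X`, so it is constant with value `r c`, and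
-- `N.○ X` contracts to `r c`.
connected-of-modal : (M N : HigherModality)
          (let module M = HigherModality M; module N = HigherModality N) →
          (∀ X → M.isModal (N.○ X)) → ∀ X → M.isConnected X → N.isConnected X
connected-of-modal M N modal X (c , h) = r c , ON.○-≡-elim (const (r c)) id
  (λ x → trans (cong r (h (M.η x))) (OM.into-modal-η (modal X) x N.η))
  where
  module M = HigherModality M
  module N = HigherModality N
  module OM = Modality M
  module ON = Modality N
  r : M.○ X → N.○ X
  r z = OM.into-modal (modal X) z N.η

-- Nullification at propositions

module NullModality {A : Set} {B : A → Set} (irr : ∀ a → Irrelevant (B a)) where

  -- A function on `B a` extends to `○ (B a)` and is evaluated at `h a`. As `○ (B a)` is a
  -- proposition, `h a` agrees with `η b` for every `b`.
  null-of-inhabited : (fe : FunExt) (M : HigherModality) → (∀ a → HigherModality.○ M (B a)) →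
                      ∀ X → isNull B (HigherModality.○ M X)
  null-of-inhabited fe M h X a = ↔⇒isEquiv (mk↔ₛ′ const g
    (λ f → fe λ b → trans (cong (bind f) (○-irrelevant (irr a) (h a) (η b))) (bind-η f b))
    (λ x → into-≡ (h a) λ b →
      trans (cong (bind (const x)) (○-irrelevant (irr a) (h a) (η b))) (bind-η (const x) b)))
    where
    open HigherModality M
    open Modality M
    g : (B a → ○ X) → ○ X
    g f = bind f (h a)

  -- `○ (B a)` is null, so `η` on `B a` is a constant function; its value is the required point.
  inhabited : (N : Nullification B) → ∀ a → Nullification.○ N (B a)
  inhabited N a = proj₁ (proj₁ (Equivalence.to (modal⇔null _) (○-modal _) a η))
    where
    open Nullification N
    open Modality modality

-- Nullification at ¬¬-inhabited propositions

module TotalNullification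
  (fe : FunExt) (ua : Univalence) (C : StablePropClassifier)
  {A : Set} {B : A → Set} (irr : ∀ a → Irrelevant (B a)) (total : ∀ a → ¬ ¬ B a)
  (N : Nullification B) where

  open StablePropClassifier C
  open NablaGroup fe ua C using (⌜_⌝; ⌜⌝-intro; ⌜⌝-elim; ⟦⟧-stable; Ω¬¬-ext; ¬¬-map)
  open Nullification N
  open Modality modality

  ⊥-modal : isModal ⊥
  ⊥-modal = Equivalence.from (modal⇔null ⊥) λ a f → contradiction f (total a)

  ○⇒¬¬ : ○ X → ¬ ¬ X
  ○⇒¬¬ = into-modal ⊥-modal

  -- A map `f` from the proposition `B a` is constant. Its value is recovered as ¬¬ of the existence
  -- of a `b` with `f b`, using that `B a` is ¬¬-inhabited.
  Ω¬¬-modal : isModal Ω¬¬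
  Ω¬¬-modal = Equivalence.from (modal⇔null Ω¬¬) λ a → ↔⇒isEquiv (mk↔ₛ′ const
    (λ f → ⌜ Σ[ b ∈ B a ] ⟦ f b ⟧ ⌝)
    (λ f → fe λ b → Ω¬¬-ext
      (λ p → ⟦⟧-stable _ λ k → ⌜⌝-elim p λ { (b′ , q) → k (subst (⟦_⟧ ∘ f) (irr a b′ b) q) })
      (λ p → ⌜⌝-intro λ k → k (b , p)))
    (λ ω → Ω¬¬-ext
      (λ p → ⟦⟧-stable _ λ k → ⌜⌝-elim p (k ∘ proj₂))
      (λ p → ⌜⌝-intro (¬¬-map (_, p) (total a)))))

  -- As `Ω¬¬` is modal, the predicate ¬¬ (`x ≡ y`) of `y` extends to `○ X`; it is transported along
  -- the given path from its reflexive instance.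
  η-¬¬-injective : {x y : X} → η x ≡ η y → ¬ ¬ (x ≡ y)
  η-¬¬-injective {x = x} {y} e =
    ⌜⌝-elim (subst ⟦_⟧ (trans (sym (char-η x)) (trans (cong char e) (char-η y)))
      (⌜⌝-intro λ k → k refl))
    where
    char : ○ _ → Ω¬¬
    char z = into-modal Ω¬¬-modal z (λ y → ⌜ x ≡ y ⌝)
    char-η : ∀ y → char (η y) ≡ ⌜ x ≡ y ⌝
    char-η y = into-modal-η Ω¬¬-modal y _

  ¬¬-attained : (z : ○ X) → ¬ ¬ (Σ[ x ∈ X ] η x ≡ z)
  ¬¬-attained z = ○⇒¬¬ (attained z)

  module _ (_≟_ : DecidableEquality X) where

    η-injective : Injective _≡_ _≡_ (η {X})
    η-injective e = decidable-stable (_ ≟ _) (η-¬¬-injective e)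

    -- Under the modality both points come from `X`, where equality is decidable. Stability licenses
    -- classical case distinctions in proofs of equations in `○ X`.
    ○-≡-stable : {z w : ○ X} → Stable (z ≡ w)
    ○-≡-stable {z} {w} n = into-≡ (attained z) λ { (x , refl) →
      into-≡ (attained w) λ { (y , refl) →
        cong η (decidable-stable (x ≟ y) λ k → n (k ∘ η-injective)) } }

-- Six is a common multiple of the orders 1, 2 and 3 that a product of two transpositions can have.
sixfold : (Y → Y) → Y → Y
sixfold f = f ∘ f ∘ f ∘ f ∘ f ∘ f

conjugates : (Y → Y) → (Y → Y) → (Y → Y) → ℕ → Y → Y
conjugates g g⁻ f zero    = f
conjugates g g⁻ f (suc n) = g⁻ ∘ conjugates g g⁻ f n ∘ g

-- Groups of permutations up to double negation

-- An interface to `∇₀ (Ω𝒰 Y)`. An element denotes a permutation only up to ¬¬, and `ξ ⊩ f` says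
-- that `f` is that permutation; stable equality allows a representative to be assumed when an
-- equation is proved.
record PermutationGroup (Y : Set) : Set₂ where
  infixl 7 _∙_
  infix  4 _⊩_
  field
    stable      : {x y : Y} → Stable (x ≡ y)
    Carrier     : Set₁
    _∙_         : Carrier → Carrier → Carrier
    ε           : Carrier
    ≡-stable    : {ξ ζ : Carrier} → Stable (ξ ≡ ζ)
    _⊩_         : Carrier → (Y → Y) → Set₁
    ⊩-total     : ∀ ξ → ¬ ¬ (Σ[ f ∈ (Y → Y) ] ξ ⊩ f)
    ⊩-ε         : ε ⊩ id
    -- Paths compose left to right, so the left factor acts first.
    ⊩-∙         : ∀ {ξ ζ f g} → ξ ⊩ f → ζ ⊩ g → ξ ∙ ζ ⊩ g ∘ f
    ⊩-injective : ∀ {ξ f} → ξ ⊩ f → Injective _≡_ _≡_ f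
    ⊩-ext       : ∀ {ξ ζ f g} → ξ ⊩ f → ζ ⊩ g → (∀ y → f y ≡ g y) → ξ ≡ ζ
    ⊩-≡         : ∀ {ξ ζ f g} → ξ ⊩ f → ζ ⊩ g → ξ ≡ ζ → ∀ y → f y ≡ g y
    realize     : (f g : Y → Y) → (∀ y → f (g y) ≡ y) → (∀ y → g (f y) ≡ y) →
                  Σ[ ξ ∈ Carrier ] ξ ⊩ f

  sixth : Carrier → Carrier
  sixth ξ = ξ ∙ (ξ ∙ (ξ ∙ (ξ ∙ (ξ ∙ ξ))))

  conjugates∙ : Carrier → Carrier → Carrier → ℕ → Carrier
  conjugates∙ γ γ⁻ ξ zero    = ξ
  conjugates∙ γ γ⁻ ξ (suc n) = γ ∙ (conjugates∙ γ γ⁻ ξ n ∙ γ⁻)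

  ⊩-sixth : ∀ {ξ f} → ξ ⊩ f → sixth ξ ⊩ sixfold f
  ⊩-sixth r = ⊩-∙ r (⊩-∙ r (⊩-∙ r (⊩-∙ r (⊩-∙ r r))))

  ⊩-conjugates : ∀ {γ γ⁻ ξ g g⁻ f} → γ ⊩ g → γ⁻ ⊩ g⁻ → ξ ⊩ f →
                 ∀ n → conjugates∙ γ γ⁻ ξ n ⊩ conjugates g g⁻ f n
  ⊩-conjugates r r⁻ s zero    = s
  ⊩-conjugates r r⁻ s (suc n) = ⊩-∙ r (⊩-∙ (⊩-conjugates r r⁻ s n) r⁻)

-- Loops in the universe as permutations

module LoopPermutations (fe : FunExt) (ua : Univalence) (C : StablePropClassifier)
  {Y : Set} (stable : {x y : Y} → Stable (x ≡ y)) where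

  open Nabla C
  open NablaGroup fe ua C
  open LoopGroup Y

  isContr-irr : Irrelevant X → Irrelevant (isContr X)
  isContr-irr irr (c , h) (c′ , h′) with refl ← h c′ =
    cong (c ,_) (fe λ x → Irrelevant⇒isSet irr _ _)

  isEquiv-irr : (f : Y → Y) → Irrelevant (isEquiv f)
  isEquiv-irr f e e′ = fe λ y → isContr-irr
    (λ u v → trans (sym (proj₂ (e y) u)) (proj₂ (e y) v)) (e y) (e′ y)

  act : X ≡ Y → X → Y
  act p = proj₁ (≡⇒≃ p)

  act-trans : (p : X ≡ Y) (q : Y ≡ Y) → ∀ x → act (trans p q) x ≡ act q (act p x)
  act-trans refl q x = refl

  act-injective : (p : X ≡ Y) → Injective _≡_ _≡_ (act p)
  act-injective refl e = e

  act-ext : {p q : Y ≡ Y} → (∀ y → act p y ≡ act q y) → p ≡ q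
  act-ext {p} {q} h = trans (sym (strictlyInverseʳ p))
    (trans (cong from (Σ-≡ isEquiv-irr (fe h))) (strictlyInverseʳ q))
    where open Inverse (isEquiv⇒↔ (ua Y Y)) using (from; strictlyInverseʳ)

  infix 4 _⊩_
  record _⊩_ (ξ : ∇₀ (Ω𝒰 Y)) (f : Y → Y) : Set₁ where
    constructor by
    field
      path  : Ω𝒰 Y
      holds : ξ ↓= path
      acts  : ∀ y → act path y ≡ f y

  ⊩-total : ∀ ξ → ¬ ¬ (Σ[ f ∈ (Y → Y) ] ξ ⊩ f)
  ⊩-total ξ k = total ξ λ { (p , s) → k (act p , by p s λ _ → refl) }

  ⊩-ε : ε ⊩ id
  ⊩-ε = by refl ε-↓= λ _ → refl

  ⊩-∙ : ∀ {ξ ζ f g} → ξ ⊩ f → ζ ⊩ g → ξ ∙ ζ ⊩ g ∘ f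
  ⊩-∙ {ξ} {ζ} {f} {g} (by p s h) (by q t h′) = by (trans p q) (∙-↓= ξ ζ s t) λ y →
    trans (act-trans p q y) (trans (h′ (act p y)) (cong g (h y)))

  ⊩-injective : ∀ {ξ f} → ξ ⊩ f → Injective _≡_ _≡_ f
  ⊩-injective (by p s h) e = act-injective p (trans (h _) (trans e (sym (h _))))

  ⊩-ext : ∀ {ξ ζ f g} → ξ ⊩ f → ζ ⊩ g → (∀ y → f y ≡ g y) → ξ ≡ ζ
  ⊩-ext {ξ} {ζ} (by p s h) (by q t h′) e = overlap⇒≡ λ k → k
    (p , s , subst (ζ ↓=_) (act-ext λ y → trans (h′ y) (sym (trans (h y) (e y)))) t)

  -- Two values of one `ξ` are equal only up to ¬¬; stable equality in `Y` removes the double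
  -- negation.
  ⊩-≡ : ∀ {ξ ζ f g} → ξ ⊩ f → ζ ⊩ g → ξ ≡ ζ → ∀ y → f y ≡ g y
  ⊩-≡ {ξ} (by p s h) (by q t h′) refl y = stable λ k →
    proj₂ (proj₂ ξ) p q s t λ { refl → k (trans (sym (h y)) (h′ y)) }

  ∇₀-stable : {ξ ζ : ∇₀ (Ω𝒰 Y)} → Stable (ξ ≡ ζ)
  ∇₀-stable {ξ} n = overlap⇒≡ λ k → n λ { refl → total ξ λ { (p , s) → k (p , s , s) } }

  realize : (f g : Y → Y) → (∀ y → f (g y) ≡ y) → (∀ y → g (f y) ≡ y) → Σ[ ξ ∈ ∇₀ (Ω𝒰 Y) ] ξ ⊩ f
  realize f g fg gf = η₀ small p , by p (η₀-↓= small p)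
    λ y → cong (λ e → proj₁ e y) (strictlyInverseˡ f≃)
    where
    open Inverse (isEquiv⇒↔ (ua Y Y)) using (from; strictlyInverseˡ)
    f≃ : Y ≃ Y
    f≃ = f , ↔⇒isEquiv (mk↔ₛ′ f g fg gf)
    p : Y ≡ Y
    p = from f≃

  permutationGroup : PermutationGroup Y
  permutationGroup = record
    { stable = stable
    ; Carrier = Group.Carrier (∇₀Ω𝒰 Y) ; _∙_ = Group._∙_ (∇₀Ω𝒰 Y) ; ε = Group.ε (∇₀Ω𝒰 Y)
    ; ≡-stable = ∇₀-stable ; _⊩_ = _⊩_ ; ⊩-total = ⊩-total ; ⊩-ε = ⊩-ε ; ⊩-∙ = ⊩-∙
    ; ⊩-injective = ⊩-injective ; ⊩-ext = ⊩-ext ; ⊩-≡ = ⊩-≡ ; realize = realize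
    }

-- Transpositions

record Transposes {Y : Set} (f : Y → Y) (x y : Y) : Set where
  field
    on-fst    : f x ≡ y
    on-snd    : f y ≡ x
    elsewhere : ∀ z → ¬ z ≡ x → ¬ z ≡ y → f z ≡ z

open Transposes

module Transpositions {Y : Set} (stable : {x y : Y} → Stable (x ≡ y)) where

  Involutive : (Y → Y) → Set
  Involutive f = ∀ y → f (f y) ≡ y

  flip : ∀ {f} {x y : Y} → Transposes f x y → Transposes f y x
  flip t = record { on-fst = on-snd t ; on-snd = on-fst t ; elsewhere = λ z n m → elsewhere t z m n }

  unique : ∀ {f g} {x y : Y} → Transposes f x y → Transposes g x y → ∀ z → f z ≡ g z
  unique {x = x} {y} t s z =
    by-cases (z ≡ x) stable λ { (yes refl) → trans (on-fst t) (sym (on-fst s)) ; (no n) →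
    by-cases (z ≡ y) stable λ { (yes refl) → trans (on-snd t) (sym (on-snd s)) ; (no m) →
    trans (elsewhere t z n m) (sym (elsewhere s z n m)) } }

  involutive : ∀ {f} {x y : Y} → Transposes f x y → Involutive f
  involutive {f} {x} {y} t z =
    by-cases (z ≡ x) stable λ { (yes refl) → trans (cong f (on-fst t)) (on-snd t) ; (no n) →
    by-cases (z ≡ y) stable λ { (yes refl) → trans (cong f (on-snd t)) (on-fst t) ; (no m) →
    trans (cong f (elsewhere t z n m)) (elsewhere t z n m) } }

  conjugate : ∀ {f x y} → Transposes f x y → (g : Y → Y) → Involutive g →
              Transposes (g ∘ f ∘ g) (g x) (g y)
  conjugate {f} {x} {y} t g i = record
    { on-fst = cong g (trans (cong f (i x)) (on-fst t))
    ; on-snd = cong g (trans (cong f (i y)) (on-snd t))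
    ; elsewhere = λ z n m → trans
        (cong g (elsewhere t (g z) (λ { refl → n (sym (i z)) }) (λ { refl → m (sym (i z)) })))
        (i z)
    }

  period-2 : (w : Y → Y) → (∀ y → w (w y) ≡ y) → ∀ y → sixfold w y ≡ y
  period-2 w h y = trans (h _) (trans (h _) (h _))

  period-3 : (w : Y → Y) → (∀ y → w (w (w y)) ≡ y) → ∀ y → sixfold w y ≡ y
  period-3 w h y = trans (h _) (h _)

  module _ {t s : Y → Y} where

    -- With common point x, both tst and sts transpose y and z.
    overlapping : ∀ {x y z} → ¬ x ≡ y → ¬ x ≡ z → Transposes t x y → Transposes s x z →
                  ∀ v → sixfold (s ∘ t) v ≡ v
    overlapping {x} {y} {z} x≢y x≢z T S v = by-cases (y ≡ z) stable λ
      { (yes y≡z) → period-2 (s ∘ t) (λ u → trans (equal y≡z _) (equal y≡z u)) v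
      ; (no y≢z) → period-3 (s ∘ t) (λ u →
          trans (cong (s ∘ t ∘ s) (braid y≢z u)) (trans (cong (s ∘ t) (involutive S _)) (cancel u))) v }
      where
      equal : y ≡ z → ∀ u → s (t u) ≡ u
      equal refl u = trans (unique S T (t u)) (involutive T u)
      braid : ¬ y ≡ z → ∀ u → t (s (t u)) ≡ s (t (s u))
      braid y≢z = unique
        (subst₂ (Transposes _) (on-fst T) (elsewhere T z (x≢z ∘ sym) (y≢z ∘ sym))
          (conjugate S t (involutive T)))
        (flip (subst₂ (Transposes _) (on-fst S) (elsewhere S y (x≢y ∘ sym) y≢z)
          (conjugate T s (involutive S))))
      cancel : ∀ u → s (t (t (s u))) ≡ u
      cancel u = trans (cong s (involutive T (s u))) (involutive S u)

    -- Conjugation by `t` leaves `z` and `w` in place, so tst = s by uniqueness and (st)² = s² = 1.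
    disjoint : ∀ {x y z w} → ¬ z ≡ x → ¬ z ≡ y → ¬ w ≡ x → ¬ w ≡ y →
               Transposes t x y → Transposes s z w → ∀ v → sixfold (s ∘ t) v ≡ v
    disjoint z≢x z≢y w≢x w≢y T S = period-2 (s ∘ t) λ u →
      trans (cong s (unique (subst₂ (Transposes _) (elsewhere T _ z≢x z≢y) (elsewhere T _ w≢x w≢y)
        (conjugate S t (involutive T))) S u)) (involutive S u)

    product-period : ∀ {x y z w} → ¬ x ≡ y → ¬ z ≡ w → Transposes t x y → Transposes s z w →
                     ∀ v → sixfold (s ∘ t) v ≡ v
    product-period {x} {y} {z} {w} x≢y z≢w T S v =
      by-cases (z ≡ x) stable λ { (yes refl) → overlapping x≢y z≢w T S v ; (no z≢x) →
      by-cases (z ≡ y) stable λ { (yes refl) → overlapping (x≢y ∘ sym) z≢w (flip T) S v ; (no z≢y) →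
      by-cases (w ≡ x) stable λ { (yes refl) → overlapping x≢y (z≢w ∘ sym) T (flip S) v ; (no w≢x) →
      by-cases (w ≡ y) stable λ { (yes refl) → overlapping (x≢y ∘ sym) (z≢w ∘ sym) (flip T) (flip S) v ; (no w≢y) →
      disjoint z≢x z≢y w≢x w≢y T S v } } } }

  -- Turns commutation with a transposition into a single equation, which an oracle computation can
  -- test.
  commutes-of-commutes-at : ∀ {t f x y} → ¬ x ≡ y → Transposes t x y → Injective _≡_ _≡_ f →
                            f (t x) ≡ t (f x) → ∀ z → f (t z) ≡ t (f z)
  commutes-of-commutes-at {t} {f} {x} {y} x≢y T inj e z =
    by-cases (z ≡ x) stable λ { (yes refl) → e ; (no z≢x) →
    by-cases (z ≡ y) stable λ { (yes refl) → at-y ; (no z≢y) →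
    trans (cong f (elsewhere T z z≢x z≢y)) (sym (away z z≢x z≢y)) } }
    where
    f-y : f y ≡ t (f x)
    f-y = trans (cong f (sym (on-fst T))) e
    at-y : f (t y) ≡ t (f y)
    at-y = trans (cong f (on-snd T)) (sym (trans (cong t f-y) (involutive T (f x))))
    -- f y = t (f x) differs from f x, so f x is x or y and f permutes {x , y}.
    away : ∀ z → ¬ z ≡ x → ¬ z ≡ y → t (f z) ≡ f z
    away z z≢x z≢y =
      by-cases (f x ≡ x) stable λ { (yes p) → elsewhere T (f z)
        (λ q → z≢x (inj (trans q (sym p))))
        (λ q → z≢y (inj (trans q (sym (trans f-y (trans (cong t p) (on-fst T))))))) ; (no p) →
      by-cases (f x ≡ y) stable λ { (yes q) → elsewhere T (f z)
        (λ r → z≢y (inj (trans r (sym (trans f-y (trans (cong t q) (on-snd T)))))))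
        (λ r → z≢x (inj (trans r (sym q)))) ; (no q) →
      contradiction (inj (sym (trans f-y (elsewhere T (f x) p q)))) x≢y } }

-- Extending finite permutations to all natural numbers

module _ {k : ℕ} (x : Fin k → ℕ) (inj : Injective _≡_ _≡_ x) (c : Fin k → Fin k) where

  extend : ℕ → ℕ
  extend n with any? (λ i → x i ℕ.≟ n)
  ... | yes (i , _) = x (c i)
  ... | no _        = n

  extend-image : ∀ i → extend (x i) ≡ x (c i)
  extend-image i with any? (λ j → x j ℕ.≟ x i)
  ... | yes (j , e) = cong (x ∘ c) (inj e)
  ... | no n        = contradiction (i , refl) n

  extend-involutive : (∀ i → c (c i) ≡ i) → ∀ n → extend (extend n) ≡ n
  extend-involutive h n with any? (λ i → x i ℕ.≟ n) in eq
  ... | yes (i , refl) = trans (extend-image (c i)) (cong x (h i))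
  -- The outer `extend` repeats the test on the same `n`, and `eq` records that it fails.
  ... | no _ rewrite eq = refl

fresh : ∀ {k} (xs : Vec ℕ k) → Σ[ n ∈ ℕ ] All (λ x → ¬ n ≡ x) xs
fresh xs = let n , h = bound xs in n , All.map (λ { x<n refl → ℕ.<-irrefl refl x<n }) h
  where
  bound : ∀ {k} (xs : Vec ℕ k) → Σ[ n ∈ ℕ ] All (_< n) xs
  bound []       = 0 , []
  bound (x ∷ xs) = let n , h = bound xs in
    suc x ⊔ n , ℕ.m≤m⊔n _ n ∷ All.map (λ x<n → ℕ.≤-trans x<n (ℕ.m≤n⊔m _ _)) h

-- The permutation (0 1)(2 3)..., which fixes the last index when `k` is odd.
neighbour : ∀ {k} → Fin k → Fin k
neighbour {suc zero}    0F            = 0F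
neighbour {suc (suc k)} 0F            = 1F
neighbour {suc (suc k)} 1F            = 0F
neighbour {suc (suc k)} (suc (suc i)) = suc (suc (neighbour i))

lift-involutive : ∀ {k} {c : Fin k → Fin k} → (∀ i → c (c i) ≡ i) →
                  ∀ i → lift 1 c (lift 1 c i) ≡ i
lift-involutive h 0F      = refl
lift-involutive h (suc i) = cong suc (h i)

-- Recognizing transpositions among involutions

module TranspositionRecognition {Y : Set} (stable : {x y : Y} → Stable (x ≡ y))
  (e : ℕ → Y) (e-injective : Injective _≡_ _≡_ e) (e-surjective : ∀ y → ¬ ¬ (Σ[ n ∈ ℕ ] e n ≡ y))
  (map : (ℕ → ℕ) → Y → Y) (map-e : ∀ r n → map r (e n) ≡ e (r n))
  (t : Y → Y) (t-involutive : ∀ y → t (t y) ≡ y)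
  (period : ∀ r → (∀ n → r (r n) ≡ n) → ∀ y → sixfold (map r ∘ t ∘ map r ∘ t) y ≡ y)
  where

  -- The permutation c of the indices extends to a permutation of ℕ along xs.
  finite-period : ∀ {k} (xs : Vec ℕ k) → Unique xs → (τ c : Fin k → Fin k) →
    (∀ i → c (c i) ≡ i) → (∀ i → t (e (lookup xs i)) ≡ e (lookup xs (τ i))) →
    ∀ i → let ω = c ∘ τ ∘ c ∘ τ in ω (ω (ω (ω (ω (ω i))))) ≡ i
  finite-period xs u τ c c-involutive h i = inj (e-injective (trans (sym six)
    (period r (extend-involutive x inj c c-involutive) (p i))))
    where
    x = lookup xs
    p = e ∘ x
    inj : Injective _≡_ _≡_ x
    inj = lookup-injective u _ _
    r = extend x inj c
    w = map r ∘ t ∘ map r ∘ t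
    ω = c ∘ τ ∘ c ∘ τ
    map-r : ∀ i → map r (p i) ≡ p (c i)
    map-r i = trans (map-e r (x i)) (cong e (extend-image x inj c i))
    half : ∀ i → map r (t (p i)) ≡ p (c (τ i))
    half i = trans (cong (map r) (h i)) (map-r (τ i))
    step : ∀ {y i} → y ≡ p i → w y ≡ p (ω i)
    step {i = i} refl = trans (cong (map r ∘ t) (half i)) (half (c (τ i)))
    six : sixfold w (p i) ≡ p (ω (ω (ω (ω (ω (ω i))))))
    six = step (step (step (step (step (step refl)))))

  record Paired {k : ℕ} (xs : Vec ℕ k) : Set where
    constructor _,_
    field
      distinct : Unique xs
      pairs    : ∀ i → t (e (lookup xs i)) ≡ e (lookup xs (neighbour i))

  open Paired

  Paired-[] : Paired []
  Paired-[] = [] , λ ()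

  Moved : ℕ → Set
  Moved n = ¬ t (e n) ≡ e n

  -- The partner is the `m` with `e m ≡ t (e n)`. It differs from `n` because `n` is moved, and it
  -- is not in `xs` because `t` keeps the entries of `xs` among themselves and would put `n` there
  -- too.
  pair-up : ∀ {k} {xs : Vec ℕ k} → Paired xs → ∀ n → All (λ x → ¬ n ≡ x) xs → Moved n →
            ¬ ¬ (Σ[ m ∈ ℕ ] Paired (m ∷ n ∷ xs))
  pair-up {xs = xs} (u , p) n new moved k = e-surjective (t (e n)) λ { (m , em) →
    let tm : t (e m) ≡ e n
        tm = trans (cong t em) (t-involutive (e n))
    in k (m ,
      ( ( (λ { refl → moved (sym em) })
          ∷ lookup⁻ (λ { i refl → lookup⁺ new (neighbour i) (e-injective (trans (sym tm) (p i))) }))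
        ∷ new ∷ u
      , λ { 0F → tm ; 1F → sym em ; (suc (suc i)) → p i } )) }

  -- If `n` were fixed, `t` would act on the five indices as (1 2)(3 4). With `opposite` = (0 4)(1
  -- 3) the product is a 5-cycle, so its square ω satisfies ω⁶ = ω, which sends 2 to 0.
  all-moved-of-two-pairs : {xs : Vec ℕ 4} → Paired xs → ∀ n → All (λ x → ¬ n ≡ x) xs → Moved n
  all-moved-of-two-pairs {xs} (u , p) n new fixed
    with () ← finite-period (n ∷ xs) (new ∷ u) (lift 1 neighbour) opposite opposite-involutive
           (λ { 0F → fixed ; (suc i) → p i }) 2F

  -- Here c = (1 7)(2 6)(3 5), and its product with (0 1)(2 3)(4 5)(6 7) is an 8-cycle. Its square ω
  -- has order 4, so ω⁶ = ω² sends 0 to 4.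
  ¬-four-pairs : {xs : Vec ℕ 8} → ¬ Paired xs
  ¬-four-pairs {xs} (u , p)
    with () ← finite-period xs u neighbour (lift 1 opposite) (lift-involutive opposite-involutive) p 0F

  -- Every point outside two pairs is moved, so two fresh points with their partners complete four
  -- pairs.
  ¬-two-pairs : {xs : Vec ℕ 4} → ¬ Paired xs
  ¬-two-pairs {xs} P =
    let n , new = fresh xs in
    pair-up P n new (all-moved-of-two-pairs P n new) λ { (m , Q) →
    let n′ , new′ = fresh (m ∷ n ∷ xs) in
    pair-up Q n′ new′ (all-moved-of-two-pairs P n′ (All.tail (All.tail new′))) λ { (_ , R) →
    ¬-four-pairs R } }

  transposes : ∀ {x y} → Paired (x ∷ y ∷ []) → Transposes t (e x) (e y)
  transposes (u , p) = record
    { on-fst = p 0F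
    ; on-snd = p 1F
    ; elsewhere = λ z z≢x z≢y → stable λ k → e-surjective z λ { (n , refl) →
        pair-up (u , p) n ((z≢x ∘ cong e) ∷ (z≢y ∘ cong e) ∷ []) k λ { (_ , Q) → ¬-two-pairs Q } }
    }

  transposition : ¬ (∀ n → t (e n) ≡ e n) →
                  ¬ ¬ (Σ[ x ∈ ℕ ] Σ[ y ∈ ℕ ] ¬ x ≡ y × Transposes t (e x) (e y))
  transposition nontrivial k = nontrivial λ n → stable λ moved →
    pair-up Paired-[] n [] moved λ { (m , P@(((m≢n ∷ []) ∷ _) , _)) → k (m , n , m≢n , transposes P) }

-- Coding an oracle by permutations

-- f exchanges pos n and aux (1 + n) iff χ(n) is true, g shifts the line formed by neg
-- and pos and fixes aux, and u exchanges pos 0 and aux 0.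
data Strand : Set where
  pos neg aux : ℕ → Strand

up down : Strand → Strand
up (pos n)       = pos (suc n)
up (neg zero)    = pos zero
up (neg (suc n)) = neg n
up (aux n)       = aux n
down (pos zero)    = neg zero
down (pos (suc n)) = pos n
down (neg n)       = neg (suc n)
down (aux n)       = aux n

up-down : ∀ d → up (down d) ≡ d
up-down (pos zero)    = refl
up-down (pos (suc n)) = refl
up-down (neg n)       = refl
up-down (aux n)       = refl

down-up : ∀ d → down (up d) ≡ d
down-up (pos n)       = refl
down-up (neg zero)    = refl
down-up (neg (suc n)) = refl
down-up (aux n)       = refl

-- The three strands become the residue classes modulo 3.
encode : Strand → ℕ
encode (pos zero)    = 0
encode (neg zero)    = 1
encode (aux zero)    = 2
encode (pos (suc n)) = 3 + encode (pos n)
encode (neg (suc n)) = 3 + encode (neg n)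
encode (aux (suc n)) = 3 + encode (aux n)

next : Strand → Strand
next (pos n) = pos (suc n)
next (neg n) = neg (suc n)
next (aux n) = aux (suc n)

strand : ℕ → Strand
strand 0                   = pos 0
strand 1                   = neg 0
strand 2                   = aux 0
strand (suc (suc (suc n))) = next (strand n)

encode-next : ∀ d → encode (next d) ≡ 3 + encode d
encode-next (pos n) = refl
encode-next (neg n) = refl
encode-next (aux n) = refl

encode-decode : ∀ n → encode (strand n) ≡ n
encode-decode 0 = refl
encode-decode 1 = refl
encode-decode 2 = refl
encode-decode (suc (suc (suc n))) =
  trans (encode-next (strand n)) (cong (3 +_) (encode-decode n))

decode-encode : ∀ d → strand (encode d) ≡ d
decode-encode (pos zero)    = refl
decode-encode (neg zero)    = refl
decode-encode (aux zero)    = refl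
decode-encode (pos (suc n)) = cong next (decode-encode (pos n))
decode-encode (neg (suc n)) = cong next (decode-encode (neg n))
decode-encode (aux (suc n)) = cong next (decode-encode (aux n))

Strand↔ℕ : Strand ↔ ℕ
Strand↔ℕ = mk↔ₛ′ encode strand encode-decode decode-encode

_≟ₛ_ : DecidableEquality Strand
_≟ₛ_ = via-injection (mk↣ {to = encode} λ {d} {d′} e →
  trans (sym (decode-encode d)) (trans (cong strand e) (decode-encode d′))) ℕ._≟_

-- Permutations computable from an oracle

module OracleGroups (fe : FunExt) (ua : Univalence) (C : StablePropClassifier)
  (null : HasNullifications) where

  open Nabla C
  open Oracles null
  open NablaGroup fe ua C hiding (map)

  module Values (χ : Oracle ℕ Bool) where

    -- Booleans have decidable equality, so values unique up to ¬¬ are unique.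
    value-irr : ∀ n → Irrelevant (χ n ↓)
    value-irr n (b , p) (b′ , q) =
      Σ-≡ (λ _ → ⟦⟧-irr _) (decidable-stable (b Bool.≟ b′) (proj₂ (proj₂ (χ n)) b b′ p q))

    open Nullification (nullOracle χ) public
    open Modality modality public
    open TotalNullification fe ua C value-irr (λ n → total (χ n)) (nullOracle χ) public

    value : ∀ n → ○ (χ n ↓)
    value = NullModality.inhabited value-irr (nullOracle χ)

    value-≡ : ∀ {n b} (p : χ n ↓= b) → value n ≡ η (b , p)
    value-≡ p = ○-irrelevant (value-irr _) _ _

    -- Since `u` exchanges `x` and `y` and the n-th conjugate fixes `y`, that conjugate commutes
    -- with `u` exactly when it fixes `x`, that is, when `χ n` is false. The type `A` is a parameter
    -- so that a coding can be transported from `Strand` to `ℕ` by univalence.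
    record Coding (A : Set) : Set where
      field
        {u} {g} {g⁻} {f} : ○ A → ○ A
        x y              : ○ A
        x≢y              : ¬ x ≡ y
        transposes       : Transposes u x y
        g-g⁻             : ∀ z → g (g⁻ z) ≡ z
        g⁻-g             : ∀ z → g⁻ (g z) ≡ z
        f-f              : ∀ z → f (f z) ≡ z
        fixes-y          : ∀ n → conjugates g g⁻ f n y ≡ y
        fixes-x          : ∀ n → χ n ↓= false → conjugates g g⁻ f n x ≡ x
        moves-x          : ∀ n → χ n ↓= true → ¬ conjugates g g⁻ f n x ≡ x

    on-pos on-aux : ℕ → Bool → Strand
    on-pos n true  = aux (suc n)
    on-pos n false = pos n
    on-aux n true  = pos n
    on-aux n false = aux (suc n)

    swap : Strand → ○ Strand
    swap (pos n)       = map (on-pos n ∘ proj₁) (value n)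
    swap (neg n)       = η (neg n)
    -- The shift of index on `aux` keeps `aux zero` free, so that every conjugate fixes it.
    swap (aux zero)    = η (aux zero)
    swap (aux (suc n)) = map (on-aux n ∘ proj₁) (value n)

    swap-pos : ∀ {n b} → χ n ↓= b → swap (pos n) ≡ η (on-pos n b)
    swap-pos p = trans (cong (map _) (value-≡ p)) (map-η _ _)

    swap-aux : ∀ {n b} → χ n ↓= b → swap (aux (suc n)) ≡ η (on-aux n b)
    swap-aux p = trans (cong (map _) (value-≡ p)) (map-η _ _)

    f₀ g₀ g₀⁻ : ○ Strand → ○ Strand
    f₀ = bind swap
    g₀ = map up
    g₀⁻ = map down

    stableₛ : {z w : ○ Strand} → Stable (z ≡ w)
    stableₛ = ○-≡-stable _≟ₛ_

    f₀-on : ∀ {z d w} → z ≡ η d → swap d ≡ w → f₀ z ≡ w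
    f₀-on refl e = trans (bind-η swap _) e

    f₀-involutive : ∀ z → f₀ (f₀ z) ≡ z
    f₀-involutive = ○-≡-elim (f₀ ∘ f₀) id λ d → trans (cong f₀ (bind-η swap d)) (twice d)
      where
      twice : ∀ d → f₀ (swap d) ≡ η d
      -- The goal is a stable equation, so the value of `χ n` may be taken as known.
      twice (pos n) = stableₛ λ k → total (χ n) λ
        { (true , p) → k (f₀-on (swap-pos p) (swap-aux p))
        ; (false , p) → k (f₀-on (swap-pos p) (swap-pos p)) }
      twice (neg n) = f₀-on refl refl
      twice (aux zero) = f₀-on refl refl
      twice (aux (suc n)) = stableₛ λ k → total (χ n) λ
        { (true , p) → k (f₀-on (swap-aux p) (swap-pos p))
        ; (false , p) → k (f₀-on (swap-aux p) (swap-aux p)) }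

    fₙ : ℕ → ○ Strand → ○ Strand
    fₙ = conjugates g₀ g₀⁻ f₀

    step : ∀ n d {d′} → fₙ n (η (up d)) ≡ η d′ → fₙ (suc n) (η d) ≡ η (down d′)
    step n d e = trans (cong (g₀⁻ ∘ fₙ n) (map-η up d)) (trans (cong g₀⁻ e) (map-η down _))

    -- The induction varies `k`, because conjugating by `g₀` first raises `pos k` to `pos (suc k)`;
    -- after `n` shifts the bit consulted is that of n + k.
    fₙ-pos-false : ∀ n k → χ (n + k) ↓= false → fₙ n (η (pos k)) ≡ η (pos k)
    fₙ-pos-false zero k p = f₀-on refl (swap-pos p)
    fₙ-pos-false (suc n) k p = step n (pos k)
      (fₙ-pos-false n (suc k) (subst (λ m → χ m ↓= false) (sym (ℕ.+-suc n k)) p))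

    fₙ-pos-true : ∀ n k → χ (n + k) ↓= true → Σ[ m ∈ ℕ ] fₙ n (η (pos k)) ≡ η (aux m)
    fₙ-pos-true zero k p = suc k , f₀-on refl (swap-pos p)
    fₙ-pos-true (suc n) k p =
      let m , e = fₙ-pos-true n (suc k) (subst (λ m → χ m ↓= true) (sym (ℕ.+-suc n k)) p)
      in m , step n (pos k) e

    fₙ-aux : ∀ n → fₙ n (η (aux 0)) ≡ η (aux 0)
    fₙ-aux zero = f₀-on refl refl
    fₙ-aux (suc n) = step n (aux 0) (fₙ-aux n)

    exchange : Strand → Strand
    exchange (pos zero) = aux zero
    exchange (aux zero) = pos zero
    exchange d          = d

    exchange-elsewhere : ∀ d → ¬ d ≡ pos 0 → ¬ d ≡ aux 0 → exchange d ≡ d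
    exchange-elsewhere (pos zero)    n m = contradiction refl n
    exchange-elsewhere (pos (suc _)) n m = refl
    exchange-elsewhere (neg _)       n m = refl
    exchange-elsewhere (aux zero)    n m = contradiction refl m
    exchange-elsewhere (aux (suc _)) n m = refl

    coding-Strand : Coding Strand
    coding-Strand = record
      { u = map exchange
      ; g-g⁻ = map-inverse up-down
      ; g⁻-g = map-inverse down-up
      ; f-f = f₀-involutive
      ; x = η (pos 0)
      ; y = η (aux 0)
      ; x≢y = λ e → pos≢aux (η-injective _≟ₛ_ e)
      ; transposes = record
          { on-fst = map-η exchange _
          ; on-snd = map-η exchange _
          ; elsewhere = λ z n m → into-≡ (attained z) λ { (d , refl) →
              trans (map-η exchange d)
                (cong η (exchange-elsewhere d (n ∘ cong η) (m ∘ cong η))) }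
          }
      ; fixes-y = fₙ-aux
      ; fixes-x = λ n p → fₙ-pos-false n 0 (subst (λ m → χ m ↓= false) (sym (ℕ.+-identityʳ n)) p)
      ; moves-x = λ n p e →
          let m , e′ = fₙ-pos-true n 0 (subst (λ m → χ m ↓= true) (sym (ℕ.+-identityʳ n)) p)
          in pos≢aux (η-injective _≟ₛ_ (trans (sym e) e′))
      }
      where
      pos≢aux : ∀ {n m} → ¬ pos n ≡ aux m
      pos≢aux ()

    coding : Coding ℕ
    coding = subst Coding (proj₁ (proj₁ (ua Strand ℕ (encode , ↔⇒isEquiv Strand↔ℕ)))) coding-Strand

  -- Reducing one oracle to the other along the isomorphism

  module Reduction (χ χ′ : Oracle ℕ Bool) where

    private
      module V  = Values χ
      module V′ = Values χ′

    module _ (P : PermutationGroup (V.○ ℕ)) (P′ : PermutationGroup (V′.○ ℕ)) where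

      private
        module P  = PermutationGroup P
        module P′ = PermutationGroup P′

      module _ (θ : P.Carrier → P′.Carrier)
               (homo : ∀ ξ ζ → θ (ξ P.∙ ζ) ≡ θ ξ P′.∙ θ ζ) (ε-homo : θ P.ε ≡ P′.ε)
               (injective : Injective _≡_ _≡_ θ) (surjective : ∀ ζ → Σ[ ξ ∈ P.Carrier ] θ ξ ≡ ζ)
               where

        open V.Coding V.coding
        open Transpositions P.stable
          using (involutive; conjugate; product-period; flip; commutes-of-commutes-at)

        υ  = proj₁ (P.realize u u (involutive transposes) (involutive transposes))
        υ⊩ = proj₂ (P.realize u u (involutive transposes) (involutive transposes))
        γ  = proj₁ (P.realize g g⁻ g-g⁻ g⁻-g)
        γ⊩ = proj₂ (P.realize g g⁻ g-g⁻ g⁻-g)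
        γ⁻  = proj₁ (P.realize g⁻ g g⁻-g g-g⁻)
        γ⁻⊩ = proj₂ (P.realize g⁻ g g⁻-g g-g⁻)
        φ  = proj₁ (P.realize f f f-f f-f)
        φ⊩ = proj₂ (P.realize f f f-f f-f)

        fₙ : ℕ → V.○ ℕ → V.○ ℕ
        fₙ = conjugates g g⁻ f

        φₙ : ℕ → P.Carrier
        φₙ = P.conjugates∙ γ γ⁻ φ

        φₙ⊩ : ∀ n → φₙ n P.⊩ fₙ n
        φₙ⊩ = P.⊩-conjugates γ⊩ γ⁻⊩ φ⊩

        homo₂ : ∀ {ξ ζ ξ′ ζ′} → θ ξ ≡ ξ′ → θ ζ ≡ ζ′ → θ (ξ P.∙ ζ) ≡ ξ′ P′.∙ ζ′
        homo₂ refl refl = homo _ _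

        θ-sixth : ∀ {ξ ξ′} → θ ξ ≡ ξ′ → θ (P.sixth ξ) ≡ P′.sixth ξ′
        θ-sixth e = homo₂ e (homo₂ e (homo₂ e (homo₂ e (homo₂ e e))))

        θ-conjugates : ∀ n → θ (φₙ n) ≡ P′.conjugates∙ (θ γ) (θ γ⁻) (θ φ) n
        θ-conjugates zero    = refl
        θ-conjugates (suc n) = homo₂ refl (homo₂ (θ-conjugates n) refl)

        υ-involutive : υ P.∙ υ ≡ P.ε
        υ-involutive = P.⊩-ext (P.⊩-∙ υ⊩ υ⊩) P.⊩-ε (involutive transposes)

        -- The conjugate of `υ` by the involution `ζ` is again a transposition, so the word is a
        -- product of two transpositions.
        υ-period : ∀ ζ → ζ P.∙ ζ ≡ P.ε → P.sixth (υ P.∙ (ζ P.∙ (υ P.∙ ζ))) ≡ P.ε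
        υ-period ζ e = P.≡-stable λ k → P.⊩-total ζ λ { (h , r) →
          let h-involutive = P.⊩-≡ (P.⊩-∙ r r) P.⊩-ε e in
          k (P.⊩-ext (P.⊩-sixth (P.⊩-∙ υ⊩ (P.⊩-∙ r (P.⊩-∙ υ⊩ r)))) P.⊩-ε
              (product-period x≢y (x≢y ∘ P.⊩-injective r) transposes
                (conjugate transposes h h-involutive))) }

        υ≢ε : ¬ υ ≡ P.ε
        υ≢ε e = x≢y (trans (sym (P.⊩-≡ υ⊩ P.⊩-ε e x)) (on-fst transposes))

        module _ {t : V′.○ ℕ → V′.○ ℕ} (t⊩ : θ υ P′.⊩ t) where

          t-involutive : ∀ z → t (t z) ≡ z
          t-involutive = P′.⊩-≡ (P′.⊩-∙ t⊩ t⊩) P′.⊩-ε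
            (trans (sym (homo υ υ)) (trans (cong θ υ-involutive) ε-homo))

          -- By surjectivity `h` is denoted by some `θ ζ`, and by injectivity `ζ` is an involution,
          -- so `υ-period` carries over through `θ`.
          t-period : ∀ h → (∀ z → h (h z) ≡ z) → ∀ z → sixfold (h ∘ t ∘ h ∘ t) z ≡ z
          t-period h h-involutive = go (P′.realize h h h-involutive h-involutive)
            where
            go : (Σ[ ζ′ ∈ P′.Carrier ] ζ′ P′.⊩ h) → ∀ z → sixfold (h ∘ t ∘ h ∘ t) z ≡ z
            go (ζ′ , r) with ζ , refl ← surjective ζ′ =
              P′.⊩-≡ (P′.⊩-sixth (P′.⊩-∙ t⊩ (P′.⊩-∙ r (P′.⊩-∙ t⊩ r)))) P′.⊩-ε
                (trans (sym (θ-sixth (homo₂ refl (homo₂ refl (homo₂ refl refl)))))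
                  (trans (cong θ (υ-period ζ ζ-involutive)) ε-homo))
              where
              ζ-involutive : ζ P.∙ ζ ≡ P.ε
              ζ-involutive = injective (trans (homo ζ ζ)
                (trans (P′.⊩-ext (P′.⊩-∙ r r) P′.⊩-ε h-involutive) (sym ε-homo)))

          t-nontrivial : ¬ (∀ n → t (V′.η n) ≡ V′.η n)
          t-nontrivial h = υ≢ε (injective (trans
            (P′.⊩-ext t⊩ P′.⊩-ε (Modality.○-≡-elim V′.modality t id h)) (sym ε-homo)))

          t-transposition : ¬ ¬ (Σ[ p ∈ ℕ ] Σ[ q ∈ ℕ ] ¬ p ≡ q × Transposes t (V′.η p) (V′.η q))
          t-transposition = TranspositionRecognition.transposition P′.stable V′.η
            (V′.η-injective ℕ._≟_) V′.¬¬-attained V′.map V′.map-η t t-involutive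
            (λ r i → t-period (V′.map r) (V′.map-inverse i)) t-nontrivial

          module _ {g′ g⁻′ f′} (g′⊩ : θ γ P′.⊩ g′) (g⁻′⊩ : θ γ⁻ P′.⊩ g⁻′) (f′⊩ : θ φ P′.⊩ f′)
                   {p q : ℕ} (p≢q : ¬ p ≡ q) (T : Transposes t (V′.η p) (V′.η q)) where

            fₙ′ : ℕ → V′.○ ℕ → V′.○ ℕ
            fₙ′ = conjugates g′ g⁻′ f′

            fₙ′⊩ : ∀ n → θ (φₙ n) P′.⊩ fₙ′ n
            fₙ′⊩ n = subst (P′._⊩ fₙ′ n) (sym (θ-conjugates n)) (P′.⊩-conjugates g′⊩ g⁻′⊩ f′⊩ n)

            -- Commutation is an equation between group elements, which a homomorphism preserves;
            -- injectivity gives the converse below.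
            commutes⇒ : ∀ n → (∀ z → fₙ n (u z) ≡ u (fₙ n z)) → ∀ z → fₙ′ n (t z) ≡ t (fₙ′ n z)
            commutes⇒ n h = P′.⊩-≡ (P′.⊩-∙ t⊩ (fₙ′⊩ n)) (P′.⊩-∙ (fₙ′⊩ n) t⊩)
              (trans (sym (homo _ _)) (trans
                (cong θ (P.⊩-ext (P.⊩-∙ υ⊩ (φₙ⊩ n)) (P.⊩-∙ (φₙ⊩ n) υ⊩) h)) (homo _ _)))

            commutes⇐ : ∀ n → (∀ z → fₙ′ n (t z) ≡ t (fₙ′ n z)) → ∀ z → fₙ n (u z) ≡ u (fₙ n z)
            commutes⇐ n h = P.⊩-≡ (P.⊩-∙ υ⊩ (φₙ⊩ n)) (P.⊩-∙ (φₙ⊩ n) υ⊩)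
              (injective (trans (homo _ _) (trans
                (P′.⊩-ext (P′.⊩-∙ t⊩ (fₙ′⊩ n)) (P′.⊩-∙ (fₙ′⊩ n) t⊩) h) (sym (homo _ _)))))

            false⇒commutes : ∀ n → χ n ↓= false → ∀ z → fₙ n (u z) ≡ u (fₙ n z)
            false⇒commutes n v = commutes-of-commutes-at (x≢y ∘ sym) (flip transposes)
              (P.⊩-injective (φₙ⊩ n))
              (trans (cong (fₙ n) (on-snd transposes)) (trans (fixes-x n v)
                (sym (trans (cong u (fixes-y n)) (on-snd transposes)))))

            commutes⇒¬true : ∀ n → (∀ z → fₙ n (u z) ≡ u (fₙ n z)) → ¬ χ n ↓= true
            commutes⇒¬true n h v = moves-x n v (trans (cong (fₙ n) (sym (on-snd transposes)))
              (trans (h y) (trans (cong u (fixes-y n)) (on-snd transposes))))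

            -- Under `V′.○` both sides of the commutation equation at `V′.η p` are numerals, whose
            -- equality is decidable. Equality yields the answer false and inequality the answer
            -- true; each is justified by a stable statement, for which `χ n` may be assumed known.
            decide : ∀ n → V′.○ (χ n ↓)
            decide n =
              V′.bind (λ { (m , e) →
              V′.bind (λ { (m′ , e′) → V′.η (from-test (m ℕ.≟ m′) e e′) })
                (V′.attained (t (fₙ′ n (V′.η p)))) })
                (V′.attained (fₙ′ n (t (V′.η p))))
              where
              from-test : ∀ {m m′} → Dec (m ≡ m′) → V′.η m ≡ fₙ′ n (t (V′.η p)) →
                          V′.η m′ ≡ t (fₙ′ n (V′.η p)) → χ n ↓
              from-test (yes refl) e e′ = false , ⟦⟧-stable _ λ k → total (χ n) λ
                { (false , v) → k v
                ; (true , v) → commutes⇒¬true n (commutes⇐ n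
                    (Transpositions.commutes-of-commutes-at P′.stable (p≢q ∘ V′.η-injective ℕ._≟_) T
                      (P′.⊩-injective (fₙ′⊩ n)) (trans (sym e) e′))) v }
              from-test (no m≢m′) e e′ = true , ⟦⟧-stable _ λ k → total (χ n) λ
                { (true , v) → k v
                ; (false , v) → m≢m′ (V′.η-injective ℕ._≟_
                    (trans e (trans (commutes⇒ n (false⇒commutes n v) (V′.η p)) (sym e′)))) }

        -- Five choices are made under ¬¬, four representatives and one pair of points. None depends
        -- on `n`, so the double negation stays outside the quantifier.
        reducible : ¬ ¬ (∀ n → V′.○ (χ n ↓))
        reducible k =
          P′.⊩-total (θ υ) λ { (_ , t⊩) →
          P′.⊩-total (θ γ) λ { (_ , g⊩) →
          P′.⊩-total (θ γ⁻) λ { (_ , g⁻⊩) →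
          P′.⊩-total (θ φ) λ { (_ , f⊩) →
          t-transposition t⊩ λ { (_ , _ , p≢q , T) →
          k (decide t⊩ g⊩ g⁻⊩ f⊩ p≢q T) } } } } }

  loopGroup : (χ : Oracle ℕ Bool) → PermutationGroup (○[ χ ] ℕ)
  loopGroup χ = LoopPermutations.permutationGroup fe ua C (Values.○-≡-stable χ ℕ._≟_)

  -- If `○[ χ′ ]` answers all queries to `χ`, its modal types `○[ χ′ ] X` are null for `χ`, and
  -- connectedness passes along.
  connected-mono : (χ χ′ : Oracle ℕ Bool) → (∀ n → ○[ χ′ ] (χ n ↓)) →
                   ∀ X → isConnected[ χ ] X → isConnected[ χ′ ] X
  connected-mono χ χ′ h = connected-of-modal N.modality N′.modality λ X →
    Equivalence.from (N.modal⇔null _)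
      (NullModality.null-of-inhabited (Values.value-irr χ) fe N′.modality h X)
    where
    module N  = Nullification (nullOracle χ)
    module N′ = Nullification (nullOracle χ′)

mainTheorem20 :
    (fe : FunExt) (ua : Univalence) (C : StablePropClassifier) (null : HasNullifications) →
    let open Nabla C
        open Oracles null
        open NablaGroup fe ua C in
    MarkovInduction →
    (χ χ′ : Oracle ℕ Bool) →
    (θ : Group.Carrier (∇₀Ω𝒰 (○[ χ ] ℕ)) → Group.Carrier (∇₀Ω𝒰 (○[ χ′ ] ℕ))) →
    IsGroupIso (∇₀Ω𝒰 (○[ χ ] ℕ)) (∇₀Ω𝒰 (○[ χ′ ] ℕ)) θ →
    ¬ ¬ (χ ≡T χ′)
mainTheorem20 fe ua C null _ χ χ′ θ iso k =
  Reduction.reducible χ χ′ (loopGroup χ) (loopGroup χ′) θ ∙-homo ε-homo injective surjective′ λ h →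
  -- The inverse isomorphism gives the reduction in the other direction.
  Reduction.reducible χ′ χ (loopGroup χ′) (loopGroup χ) θ⁻¹ θ⁻¹-homo θ⁻¹-ε θ⁻¹-injective
    (λ ξ → θ ξ , injective (θ-θ⁻¹ (θ ξ))) λ h′ →
  k λ X → mk⇔ (connected-mono χ χ′ h X) (connected-mono χ′ χ h′ X)
  where
  open Nabla C
  open Oracles null
  open NablaGroup fe ua C
  open OracleGroups fe ua C null
  module G = Group (∇₀Ω𝒰 (○[ χ ] ℕ))
  module H = Group (∇₀Ω𝒰 (○[ χ′ ] ℕ))
  open GroupMorphisms.IsGroupIsomorphism iso
  surjective′ : ∀ ζ → Σ[ ξ ∈ G.Carrier ] θ ξ ≡ ζ
  surjective′ ζ = let ξ , e = surjective ζ in ξ , e refl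
  θ⁻¹ : H.Carrier → G.Carrier
  θ⁻¹ = proj₁ ∘ surjective′
  θ-θ⁻¹ : ∀ ζ → θ (θ⁻¹ ζ) ≡ ζ
  θ-θ⁻¹ = proj₂ ∘ surjective′
  θ⁻¹-homo : ∀ ξ ζ → θ⁻¹ (ξ H.∙ ζ) ≡ θ⁻¹ ξ G.∙ θ⁻¹ ζ
  θ⁻¹-homo ξ ζ = injective (trans (θ-θ⁻¹ _)
    (sym (trans (∙-homo _ _) (cong₂ H._∙_ (θ-θ⁻¹ ξ) (θ-θ⁻¹ ζ)))))
  θ⁻¹-ε : θ⁻¹ H.ε ≡ G.ε
  θ⁻¹-ε = injective (trans (θ-θ⁻¹ _) (sym ε-homo))
  θ⁻¹-injective : Injective _≡_ _≡_ θ⁻¹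
  θ⁻¹-injective e = trans (sym (θ-θ⁻¹ _)) (trans (cong θ e) (θ-θ⁻¹ _))
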